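{- As $n\to\infty$ through the positive integers, the number of prime numbers in the interval $[8n,9n]$ goes to infinity. That is, for every positive integer $m$ there exists a positive integer $L$ such that for all integers $n\geq L$ there are at least $m$ prime numbers in the interval $[8n,9n]$. -}

module Defs where

open import Data.List using (List; filter; length; upTo)
open import Data.Nat using (ℕ; suc; _≤?_)
open import Data.Nat.Primality using (prime?)
open import Relation.Nullary.Decidable using (_×-dec_)

-- `upTo (suc b)` lists 0, …, b without repetition, so both endpoints are
-- included and each prime is counted once.
primesIn[_,_] : ℕ → ℕ → List ℕ
primesIn[ a , b ] = filter (λ p → (a ≤? p) ×-dec prime? p) (upTo (suc b))

#primesIn[_,_] : ℕ → ℕ → ℕ
#primesIn[ a , b ] = length primesIn[ a , b ]

{-# OPTIONS --safe #-}
-- Write x = 5040 u with u = ⌊n / 70⌋, so that (560 u , 630 u] = (x/9 , x/8] differs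
-- from [8n , 9n] by a bounded number of integers.  The two lists of divisors k of 5040
-- below are chosen such that
--     G(t) = Σ_{k ∈ numerator} ⌊t/k⌋ − Σ_{k ∈ denominator} ⌊t/k⌋
-- is periodic modulo 5040, at most 1 when t ≡ 8, and at most 0 otherwise.
-- In the ratio of Π_{numerator} (x/k)! to Π_{denominator} (x/k)!, a prime p occurs with
-- exponent Σ_j G(⌊x/p^j⌋) by Legendre's formula.  Hence, apart from the O(√x) primes
-- p ≤ √x, which contribute at most x each, only the primes in (x/9 , x/8] and the
-- primes p ≤ u contribute, and the latter multiply to at most 16^u (Chebyshev).  The
-- ratio itself exceeds 32^u up to a polynomial factor.  So the primes in (x/9 , x/8]
-- have a product of at least 2^u up to a factor x^O(√x), and there are many of them.
module Submission where

open import Data.Bool using (true; false; if_then_else_)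
open import Data.List using (List; []; _∷_; _∷ʳ_; _++_; filter; length; map; upTo)
open import Data.List.Properties using (filter-++; length-++; upTo-∷ʳ)
open import Data.List.Relation.Unary.All as All using (All; []; _∷_; all?)
open import Data.Nat
open import Data.Nat.Divisibility
open import Data.Nat.DivMod hiding (_div_)
open import Data.Nat.ListAction using (sum; product)
open import Data.Nat.Primality
open import Data.Nat.Primality.Factorisation using (factorise; PrimeFactorisation)
open import Data.Nat.Properties
open import Data.Nat.Tactic.RingSolver using (solve-∀)
open import Data.Product using (∃-syntax; _×_; _,_; proj₁; proj₂)
open import Data.Sum using (_⊎_; inj₁; inj₂)
open import Data.Unit using (tt)
open import Relation.Binary.PropositionalEquality
  using (_≡_; _≢_; refl; sym; trans; cong; cong₂; subst; module ≡-Reasoning)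
open import Relation.Nullary using (¬_; Dec; yes; no; does; contradiction)
open import Relation.Nullary.Decidable using (_×-dec_; toWitness)
open import Defs

-- Indicators, finite sums and products

⟦_⟧ : ∀ {a} {A : Set a} → Dec A → ℕ
⟦ d ⟧ = if does d then 1 else 0

module _ {a} {A : Set a} where

  ⟦⟧-yes : (d : Dec A) → A → ⟦ d ⟧ ≡ 1
  ⟦⟧-yes (yes _) _ = refl
  ⟦⟧-yes (no ¬a) a = contradiction a ¬a

  ⟦⟧-no : (d : Dec A) → ¬ A → ⟦ d ⟧ ≡ 0
  ⟦⟧-no (yes a) ¬a = contradiction a ¬a
  ⟦⟧-no (no _)  _  = refl

  ⟦⟧≤1 : (d : Dec A) → ⟦ d ⟧ ≤ 1
  ⟦⟧≤1 (yes _) = ≤-refl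
  ⟦⟧≤1 (no _)  = z≤n

⟦⟧-mono : ∀ {a b} {A : Set a} {B : Set b} (d : Dec A) (e : Dec B) → (A → B) → ⟦ d ⟧ ≤ ⟦ e ⟧
⟦⟧-mono (yes a) e f = ≤-reflexive (sym (⟦⟧-yes e (f a)))
⟦⟧-mono (no _)  e f = z≤n

⟦⟧-cong : ∀ {a b} {A : Set a} {B : Set b} (d : Dec A) (e : Dec B) →
          (A → B) → (B → A) → ⟦ d ⟧ ≡ ⟦ e ⟧
⟦⟧-cong d e f g = ≤-antisym (⟦⟧-mono d e f) (⟦⟧-mono e d g)

⟦⟧-⊎ : ∀ {a b c} {A : Set a} {B : Set b} {C : Set c} (d : Dec A) (e : Dec B) (f : Dec C) →
       (A → B ⊎ C) → ⟦ d ⟧ ≤ ⟦ e ⟧ + ⟦ f ⟧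
⟦⟧-⊎ (no _)  e f g = z≤n
⟦⟧-⊎ (yes a) e f g with g a
... | inj₁ b = ≤-trans (≤-reflexive (sym (⟦⟧-yes e b))) (m≤m+n _ _)
... | inj₂ c = ≤-trans (≤-reflexive (sym (⟦⟧-yes f c))) (m≤n+m _ _)

∑< ∏< : ℕ → (ℕ → ℕ) → ℕ
∑< zero    f = 0
∑< (suc n) f = ∑< n f + f n
∏< zero    f = 1
∏< (suc n) f = ∏< n f * f n

∑<-cong : ∀ n {f g} → (∀ i → f i ≡ g i) → ∑< n f ≡ ∑< n g
∑<-cong zero    eq = refl
∑<-cong (suc n) eq = cong₂ _+_ (∑<-cong n eq) (eq n)

∑<-mono : ∀ n {f g} → (∀ i → f i ≤ g i) → ∑< n f ≤ ∑< n g
∑<-mono zero    le = z≤n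
∑<-mono (suc n) le = +-mono-≤ (∑<-mono n le) (le n)

∑<-+ : ∀ n f g → ∑< n (λ i → f i + g i) ≡ ∑< n f + ∑< n g
∑<-+ zero    f g = refl
∑<-+ (suc n) f g = trans (cong (_+ (f n + g n)) (∑<-+ n f g)) (lem (∑< n f) (∑< n g) (f n) (g n))
  where
  lem : ∀ a b c d → a + b + (c + d) ≡ a + c + (b + d)
  lem = solve-∀

∑<-0 : ∀ n {f} → (∀ i → f i ≡ 0) → ∑< n f ≡ 0
∑<-0 zero    eq = refl
∑<-0 (suc n) eq = cong₂ _+_ (∑<-0 n eq) (eq n)

∑<-front : ∀ n f → ∑< (suc n) f ≡ f 0 + ∑< n (λ i → f (suc i))
∑<-front zero    f = sym (+-identityʳ (f 0))
∑<-front (suc n) f = trans (cong (_+ f (suc n)) (∑<-front n f)) (+-assoc (f 0) _ _)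

-- Only an inequality, because the empty sum may fall short of `f 0`. It serves primes above the
-- square root of the argument, where only the first power matters.
∑<-head : ∀ n f → (∀ i → f (suc i) ≡ 0) → ∑< n f ≤ f 0
∑<-head zero    f eq = z≤n
∑<-head (suc n) f eq = ≤-reflexive
  (trans (∑<-front n f) (trans (cong (f 0 +_) (∑<-0 n eq)) (+-identityʳ _)))

∏<-cong : ∀ n {f g} → (∀ i → f i ≡ g i) → ∏< n f ≡ ∏< n g
∏<-cong zero    eq = refl
∏<-cong (suc n) eq = cong₂ _*_ (∏<-cong n eq) (eq n)

∏<-mono : ∀ n {f g} → (∀ i → f i ≤ g i) → ∏< n f ≤ ∏< n g
∏<-mono zero    le = ≤-refl
∏<-mono (suc n) le = *-mono-≤ (∏<-mono n le) (le n)

∏<-* : ∀ n f g → ∏< n (λ i → f i * g i) ≡ ∏< n f * ∏< n g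
∏<-* zero    f g = refl
∏<-* (suc n) f g = trans (cong (_* (f n * g n)) (∏<-* n f g)) (lem (∏< n f) (∏< n g) (f n) (g n))
  where
  lem : ∀ a b c d → a * b * (c * d) ≡ a * c * (b * d)
  lem = solve-∀

∏<-1 : ∀ n {f} → (∀ i → f i ≡ 1) → ∏< n f ≡ 1
∏<-1 zero    eq = refl
∏<-1 (suc n) eq = cong₂ _*_ (∏<-1 n eq) (eq n)

∏<-^ : ∀ x n f → ∏< n (λ i → x ^ f i) ≡ x ^ ∑< n f
∏<-^ x zero    f = refl
∏<-^ x (suc n) f = trans (cong (_* x ^ f n) (∏<-^ x n f)) (sym (^-distribˡ-+-* x (∑< n f) (f n)))

∑<-≟ : ∀ n p → p < n → ∑< n (λ i → ⟦ i ≟ p ⟧) ≡ 1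
∑<-≟ (suc n) p p<1+n with m≤n⇒m<n∨m≡n (s≤s⁻¹ p<1+n)
... | inj₁ p<n  = cong₂ _+_ (∑<-≟ n p p<n) (⟦⟧-no (n ≟ p) (λ n≡p → <⇒≢ p<n (sym n≡p)))
... | inj₂ refl = cong₂ _+_ (below n ≤-refl) (⟦⟧-yes (n ≟ n) refl)
  where
  below : ∀ m → m ≤ n → ∑< m (λ i → ⟦ i ≟ n ⟧) ≡ 0
  below zero    _   = refl
  below (suc m) m<n = cong₂ _+_ (below m (<⇒≤ m<n)) (⟦⟧-no (m ≟ n) (<⇒≢ m<n))

∑<-≟≤1 : ∀ n p → ∑< n (λ i → ⟦ i ≟ p ⟧) ≤ 1
∑<-≟≤1 zero    p = z≤n
∑<-≟≤1 (suc n) p with p <? suc n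
... | yes p<1+n = ≤-reflexive (∑<-≟ (suc n) p p<1+n)
... | no p≮1+n  = subst (_≤ 1) (sym (trans (cong (∑< n (λ i → ⟦ i ≟ p ⟧) +_)
  (⟦⟧-no (n ≟ p) λ { refl → p≮1+n ≤-refl })) (+-identityʳ _))) (∑<-≟≤1 n p)

-- Induction on the length `l`: the top element `a + l` accounts for at most one index, and all
-- others lie in the shorter interval. The recursive call counts that interval itself, whatever `P`
-- was.
count-≤ : ∀ n a l {ℓ} {P : ℕ → Set ℓ} (P? : ∀ i → Dec (P i)) →
          (∀ i → P i → a ≤ i × i < a + l) → ∑< n (λ i → ⟦ P? i ⟧) ≤ l
count-≤ n a zero P? P⊆ = ≤-reflexive (∑<-0 n λ i → ⟦⟧-no (P? i) λ Pi →
  let a≤i , i<a = P⊆ i Pi in <⇒≱ i<a (≤-trans (≤-reflexive (+-identityʳ a)) a≤i))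
count-≤ n a (suc l) P? P⊆ = begin
  ∑< n (λ i → ⟦ P? i ⟧)                                       ≤⟨ ∑<-mono n (λ i → ⟦⟧-⊎ (P? i) (i ≟ a + l) (Q? i) (split i)) ⟩
  ∑< n (λ i → ⟦ i ≟ a + l ⟧ + ⟦ Q? i ⟧)                       ≡⟨ ∑<-+ n _ _ ⟩
  ∑< n (λ i → ⟦ i ≟ a + l ⟧) + ∑< n (λ i → ⟦ Q? i ⟧)          ≤⟨ +-mono-≤ (∑<-≟≤1 n (a + l)) (count-≤ n a l Q? (λ _ q → q)) ⟩
  suc l                                                       ∎
  where
  open ≤-Reasoning
  Q? : ∀ i → Dec (a ≤ i × i < a + l)
  Q? i = (a ≤? i) ×-dec (i <? a + l)
  split : ∀ i → _ → i ≡ a + l ⊎ (a ≤ i × i < a + l)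
  split i Pi with P⊆ i Pi
  ... | a≤i , i<a+1+l with m≤n⇒m<n∨m≡n (s≤s⁻¹ (≤-trans i<a+1+l (≤-reflexive (+-suc a l))))
  ...   | inj₁ i<a+l = inj₂ (a≤i , i<a+l)
  ...   | inj₂ i≡a+l = inj₁ i≡a+l

-- Links the list count of the theorem to the indicator sums used everywhere else.
length-filter-upTo : ∀ {ℓ} {P : ℕ → Set ℓ} (P? : ∀ i → Dec (P i)) n →
                     length (filter P? (upTo n)) ≡ ∑< n (λ i → ⟦ P? i ⟧)
length-filter-upTo P? zero    = refl
length-filter-upTo P? (suc n) = begin
  length (filter P? (upTo (suc n)))                            ≡⟨ cong (λ is → length (filter P? is)) (upTo-∷ʳ n) ⟨
  length (filter P? (upTo n ∷ʳ n))                             ≡⟨ cong length (filter-++ P? (upTo n) (n ∷ [])) ⟩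
  length (filter P? (upTo n) ++ filter P? (n ∷ []))  ≡⟨ length-++ (filter P? (upTo n)) ⟩
  length (filter P? (upTo n)) + length (filter P? (n ∷ []))    ≡⟨ cong₂ _+_ (length-filter-upTo P? n) last ⟩
  ∑< (suc n) (λ i → ⟦ P? i ⟧)                                  ∎
  where
  open ≡-Reasoning
  last : length (filter P? (n ∷ [])) ≡ ⟦ P? n ⟧
  last with does (P? n)
  ... | true  = refl
  ... | false = refl

*-^ : ∀ m n k → (m * n) ^ k ≡ m ^ k * n ^ k
*-^ m n zero    = refl
*-^ m n (suc k) = trans (cong (m * n *_) (*-^ m n k)) (lem m n (m ^ k) (n ^ k))
  where
  lem : ∀ a b c d → a * b * (c * d) ≡ a * c * (b * d)
  lem = solve-∀

-- Legendre's formula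

-- Replacing nonprimes by 1 lets products over primes run over all indices below a bound, so that
-- they can be split and compared factor by factor.
primePart : ℕ → ℕ
primePart p = if does (prime? p) then p else 1

primePart-prime : ∀ {p} → Prime p → primePart p ≡ p
primePart-prime {p} pp with prime? p
... | yes _ = refl
... | no ¬p = contradiction pp ¬p

primePart-¬prime : ∀ {p} → ¬ Prime p → primePart p ≡ 1
primePart-¬prime {p} ¬pp with prime? p
... | yes pp = contradiction pp ¬pp
... | no _   = refl

primePart>0 : ∀ p → NonZero (primePart p)
primePart>0 p with prime? p
... | yes pp = prime⇒nonZero pp
... | no _   = _

primePart^-cong : ∀ p {e f} → (Prime p → e ≡ f) → primePart p ^ e ≡ primePart p ^ f
primePart^-cong p {e} {f} eq with prime? p
... | yes pp = cong (p ^_) (eq pp)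
... | no _   = trans (^-zeroˡ e) (sym (^-zeroˡ f))

primePart^-mono : ∀ p {e f} → (Prime p → e ≤ f) → primePart p ^ e ≤ primePart p ^ f
primePart^-mono p {e} {f} le with prime? p
... | yes pp = ^-monoʳ-≤ p {{prime⇒nonZero pp}} (le pp)
... | no _   = ≤-reflexive (trans (^-zeroˡ e) (sym (^-zeroˡ f)))

prime>1 : ∀ {p} → Prime p → 1 < p
prime>1 {p} pp = nonTrivial⇒n>1 p {{prime⇒nonTrivial pp}}

-- The exponent of a prime p in m, provided that m < p ^ suc R.
val : ℕ → ℕ → ℕ → ℕ
val R p m = ∑< R (λ j → ⟦ p ^ suc j ∣? m ⟧)

n<m^n : ∀ m n → 1 < m → n < m ^ n
n<m^n m zero    1<m = s≤s z≤n
n<m^n m (suc n) 1<m = begin-strict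
  suc n         ≤⟨ n<m^n m n 1<m ⟩
  m ^ n         <⟨ m<m*n (m ^ n) m {{m^n≢0 m n {{>-nonZero (<-trans (s≤s z≤n) 1<m)}}}} 1<m ⟩
  m ^ n * m     ≡⟨ *-comm (m ^ n) m ⟩
  m * m ^ n     ∎
  where open ≤-Reasoning

val-1 : ∀ R {p} → 1 < p → val R p 1 ≡ 0
val-1 R {p} 1<p = ∑<-0 R λ j → ⟦⟧-no (p ^ suc j ∣? 1) λ d →
  contradiction (∣1⇒≡1 d) (>⇒≢ (≤-<-trans (s≤s z≤n) (n<m^n p (suc j) 1<p)))

-- Cancelling `p` lowers every exponent by one, so the power `p ^ 0` appears and contributes 1. The
-- power `p ^ R`, missing at the other end, contributes nothing because `m < R < p ^ R`.
val-*-self : ∀ R {p m} → Prime p → .{{NonZero m}} → m < R → val R p (p * m) ≡ suc (val R p m)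
val-*-self R {p} {m} pp m<R = begin
  ∑< R (λ j → ⟦ p ^ suc j ∣? p * m ⟧) ≡⟨ ∑<-cong R (λ j → ⟦⟧-cong (p ^ suc j ∣? p * m) (p ^ j ∣? m)
                                            (*-cancelˡ-∣ p) (*-monoʳ-∣ p)) ⟩
  ∑< R g                              ≡⟨ +-identityʳ _ ⟨
  ∑< R g + 0                          ≡⟨ cong (∑< R g +_) (⟦⟧-no (p ^ R ∣? m)
                                            (>⇒∤ (<-trans m<R (n<m^n p R (prime>1 pp))))) ⟨
  ∑< (suc R) g                        ≡⟨ ∑<-front R g ⟩
  g 0 + val R p m                     ≡⟨ cong (_+ val R p m) (⟦⟧-yes (1 ∣? m) (1∣ m)) ⟩
  suc (val R p m)                     ∎
  where
  open ≡-Reasoning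
  instance _ = prime⇒nonZero pp
  g : ℕ → ℕ
  g j = ⟦ p ^ j ∣? m ⟧

-- Induction on `j`: write `m` as `c * q ^ j`, cancel `q ^ j`, and apply Euclid's lemma to
-- `q ∣ p * c`.
prime-power-∣ : ∀ {p q} → Prime q → ¬ q ∣ p → ∀ j {m} → q ^ j ∣ p * m → q ^ j ∣ m
prime-power-∣ pq q∤p zero {m} _ = 1∣ m
prime-power-∣ {p} {q} pq q∤p (suc j) {m} d
  with prime-power-∣ pq q∤p j (∣-trans (n∣m*n q) d)
... | divides c refl
  with euclidsLemma p c pq (*-cancelʳ-∣ (q ^ j) {{m^n≢0 q j {{prime⇒nonZero pq}}}}
         (subst (q ^ suc j ∣_) (sym (*-assoc p c (q ^ j))) d))
... | inj₁ q∣p = contradiction q∣p q∤p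
... | inj₂ q∣c = *-monoˡ-∣ (q ^ j) q∣c

prime∣prime : ∀ {p q} → Prime p → Prime q → q ∣ p → q ≡ p
prime∣prime pp pq q∣p with prime⇒irreducible pp q∣p
... | inj₁ q≡1 = contradiction q≡1 (>⇒≢ (prime>1 pq))
... | inj₂ q≡p = q≡p

val-*-other : ∀ R {p q m} → Prime p → Prime q → q ≢ p → val R q (p * m) ≡ val R q m
val-*-other R {p} {q} {m} pp pq q≢p = ∑<-cong R λ j → ⟦⟧-cong (q ^ suc j ∣? p * m) (q ^ suc j ∣? m)
  (prime-power-∣ pq (λ q∣p → q≢p (prime∣prime pp pq q∣p)) (suc j)) (∣n⇒∣m*n p)

-- Induction on the list: the head `p` is the product over `q` of `p` to the indicator of `q ≡ p`,
-- which merges factor by factor with the product for the tail. The same `R` bounds the primes and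
-- the exponents, which is enough for numbers below `R`.
prime-product : ∀ R ps → All Prime ps → product ps < R →
                product ps ≡ ∏< R (λ q → primePart q ^ val R q (product ps))
prime-product R [] [] _ = sym (∏<-1 R λ q →
  primePart^-cong q λ pq → val-1 R (prime>1 pq))
prime-product R (p ∷ ps) (pp ∷ pps) lt = begin
  p * m                                                       ≡⟨ cong₂ _*_ (sym p-part) (prime-product R ps pps m<R) ⟩
  ∏< R (λ q → p ^ ⟦ q ≟ p ⟧) * ∏< R (λ q → primePart q ^ val R q m) ≡⟨ ∏<-* R _ _ ⟨
  ∏< R (λ q → p ^ ⟦ q ≟ p ⟧ * primePart q ^ val R q m)        ≡⟨ ∏<-cong R step ⟩
  ∏< R (λ q → primePart q ^ val R q (p * m))                  ∎
  where
  open ≡-Reasoning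
  m = product ps
  instance
    _ = prime⇒nonZero pp
    m≢0 : NonZero m
    m≢0 = >-nonZero (productOfPrimes≥1 pps)
  m<R : m < R
  m<R = ≤-<-trans (m≤n*m m p) lt
  p<R : p < R
  p<R = ≤-<-trans (m≤m*n p m) lt
  p-part : ∏< R (λ q → p ^ ⟦ q ≟ p ⟧) ≡ p
  p-part = trans (∏<-^ p R _) (trans (cong (p ^_) (∑<-≟ R p p<R)) (^-identityʳ p))
  step : ∀ q → p ^ ⟦ q ≟ p ⟧ * primePart q ^ val R q m ≡ primePart q ^ val R q (p * m)
  step q with q ≟ p
  ... | yes refl = begin
    p ^ ⟦ p ≟ p ⟧ * primePart p ^ val R p m ≡⟨ cong (λ e → p ^ e * primePart p ^ val R p m) (⟦⟧-yes (p ≟ p) refl) ⟩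
    p ^ 1 * primePart p ^ val R p m         ≡⟨ cong (_* primePart p ^ val R p m) (^-identityʳ p) ⟩
    p * primePart p ^ val R p m             ≡⟨ cong (_* primePart p ^ val R p m) (primePart-prime pp) ⟨
    primePart p ^ suc (val R p m)           ≡⟨ cong (primePart p ^_) (val-*-self R pp m<R) ⟨
    primePart p ^ val R p (p * m)           ∎
  ... | no q≢p   = begin
    p ^ ⟦ q ≟ p ⟧ * primePart q ^ val R q m ≡⟨ cong (λ e → p ^ e * primePart q ^ val R q m) (⟦⟧-no (q ≟ p) q≢p) ⟩
    1 * primePart q ^ val R q m             ≡⟨ *-identityˡ _ ⟩
    primePart q ^ val R q m                 ≡⟨ primePart^-cong q (λ pq → sym (val-*-other R pp pq q≢p)) ⟩
    primePart q ^ val R q (p * m)           ∎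

prime-factorisation : ∀ R m → .{{NonZero m}} → m < R → m ≡ ∏< R (λ q → primePart q ^ val R q m)
prime-factorisation R m m<R = subst (λ m → m ≡ ∏< R (λ q → primePart q ^ val R q m)) (sym isFactorisation)
  (prime-product R factors factorsPrime (subst (_< R) isFactorisation m<R))
  where open PrimeFactorisation (factorise m)

-- Total division: m div 0 = 0.
infixl 7 _div_
_div_ : ℕ → ℕ → ℕ
m div zero  = 0
m div suc n = m / suc n

div≡/ : ∀ m n → .{{_ : NonZero n}} → m div n ≡ m / n
div≡/ m (suc n) = refl

-- The quotient jumps exactly when the remainder of `n` is the largest possible one, that is, when
-- `suc n` is a multiple of `q`.
suc-div : ∀ n q → .{{_ : NonZero q}} → suc n div q ≡ n div q + ⟦ q ∣? suc n ⟧
suc-div n q@(suc q′) with m≤n⇒m<n∨m≡n (m%n<n n q)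
... | inj₂ 1+r≡q = begin
  suc n / q                     ≡⟨ /-congˡ {o = q} 1+n≡ ⟩
  (suc (n / q) * q) / q         ≡⟨ m*n/n≡m (suc (n / q)) q ⟩
  suc (n / q)                   ≡⟨ +-comm 1 _ ⟩
  n / q + 1                     ≡⟨ cong (n / q +_) (⟦⟧-yes (q ∣? suc n) (divides (suc (n / q)) 1+n≡)) ⟨
  n / q + ⟦ q ∣? suc n ⟧        ∎
  where
  open ≡-Reasoning
  1+n≡ : suc n ≡ suc (n / q) * q
  1+n≡ = trans (cong suc (m≡m%n+[m/n]*n n q)) (cong (_+ n / q * q) 1+r≡q)
... | inj₁ 1+r<q = begin
  suc n / q                       ≡⟨ /-congˡ {o = q} 1+n≡ ⟩
  (suc (n % q) + n / q * q) / q   ≡⟨ +-distrib-/-∣ʳ (suc (n % q)) (n∣m*n (n / q)) ⟩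
  suc (n % q) / q + n / q * q / q ≡⟨ cong₂ _+_ (m<n⇒m/n≡0 1+r<q) (m*n/n≡m (n / q) q) ⟩
  n / q                           ≡⟨ +-identityʳ _ ⟨
  n / q + 0                       ≡⟨ cong (n / q +_) (⟦⟧-no (q ∣? suc n) ∤1+n) ⟨
  n / q + ⟦ q ∣? suc n ⟧          ∎
  where
  open ≡-Reasoning
  1+n≡ : suc n ≡ suc (n % q) + n / q * q
  1+n≡ = cong suc (m≡m%n+[m/n]*n n q)
  ∤1+n : ¬ q ∣ suc n
  ∤1+n d = contradiction
    (∣m+n∣m⇒∣n (subst (q ∣_) (trans 1+n≡ (+-comm _ (n / q * q))) d) (n∣m*n (n / q)))
    (>⇒∤ 1+r<q)

-- The exponent of a prime p in n !, provided that n < p ^ suc R.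
legendre : ℕ → ℕ → ℕ → ℕ
legendre R p n = ∑< R (λ j → n div p ^ suc j)

-- Sums `suc-div` over the powers of `p`; this is the induction step of Legendre's formula.
legendre-suc : ∀ R p n → .{{NonZero p}} → legendre R p (suc n) ≡ val R p (suc n) + legendre R p n
legendre-suc R p n = trans
  (∑<-cong R λ j → trans (suc-div n (p ^ suc j) {{m^n≢0 p (suc j)}}) (+-comm (n div p ^ suc j) _))
  (∑<-+ R _ _)

legendre-0 : ∀ R p → .{{NonZero p}} → legendre R p 0 ≡ 0
legendre-0 R p = ∑<-0 R λ j →
  trans (div≡/ 0 (p ^ suc j) {{m^n≢0 p (suc j)}}) (0/n≡0 (p ^ suc j) {{m^n≢0 p (suc j)}})

!-legendre : ∀ R n → n < R → n ! ≡ ∏< R (λ p → primePart p ^ legendre R p n)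
!-legendre R zero    _ = sym (∏<-1 R λ p →
  primePart^-cong p λ pp → legendre-0 R p {{prime⇒nonZero pp}})
!-legendre R (suc n) n<R = begin
  suc n * n !                                                ≡⟨ cong₂ _*_ (prime-factorisation R (suc n) n<R) (!-legendre R n (<⇒≤ n<R)) ⟩
  ∏< R (λ p → primePart p ^ val R p (suc n)) * ∏< R (λ p → primePart p ^ legendre R p n) ≡⟨ ∏<-* R _ _ ⟨
  ∏< R (λ p → primePart p ^ val R p (suc n) * primePart p ^ legendre R p n) ≡⟨ ∏<-cong R (λ p → trans
      (sym (^-distribˡ-+-* (primePart p) (val R p (suc n)) (legendre R p n)))
      (primePart^-cong p λ pp → sym (legendre-suc R p n {{prime⇒nonZero pp}}))) ⟩
  ∏< R (λ p → primePart p ^ legendre R p (suc n))            ∎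
  where open ≡-Reasoning

-- Factorials and Chebyshev's primorial bound

[k+n]!≤ : ∀ k n → (k + n) ! ≤ (k + n) ^ k * n !
[k+n]!≤ zero    n = ≤-reflexive (sym (+-identityʳ (n !)))
[k+n]!≤ (suc k) n = begin
  suc (k + n) * (k + n) !                 ≤⟨ *-monoʳ-≤ (suc (k + n)) ([k+n]!≤ k n) ⟩
  suc (k + n) * ((k + n) ^ k * n !)       ≤⟨ *-monoʳ-≤ (suc (k + n)) (*-monoˡ-≤ (n !) (^-monoˡ-≤ k (n≤1+n (k + n)))) ⟩
  suc (k + n) * (suc (k + n) ^ k * n !)   ≡⟨ *-assoc (suc (k + n)) (suc (k + n) ^ k) (n !) ⟨
  suc (k + n) ^ suc k * n !               ∎
  where open ≤-Reasoning

n^k*n!≤[k+n]! : ∀ k n → n ^ k * n ! ≤ (k + n) !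
n^k*n!≤[k+n]! zero    n = ≤-reflexive (+-identityʳ (n !))
n^k*n!≤[k+n]! (suc k) n = begin
  n * n ^ k * n !           ≡⟨ *-assoc n _ _ ⟩
  n * (n ^ k * n !)         ≤⟨ *-mono-≤ (≤-trans (m≤n+m n k) (n≤1+n (k + n))) (n^k*n!≤[k+n]! k n) ⟩
  suc (k + n) * (k + n) !   ∎
  where open ≤-Reasoning

-- (b u)! is b^(bu) (u!)^b up to the factor (b u)^b, so in a balanced ratio the powers of u!
-- cancel and no Stirling formula is needed.
[bu]!≤ : ∀ b u → (b * u) ! ≤ (b ^ b) ^ u * (u !) ^ b
[bu]!≤ b zero = ≤-reflexive (trans (cong _! (*-zeroʳ b)) (sym (trans (+-identityʳ _) (^-zeroˡ b))))
[bu]!≤ b (suc u) = begin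
  (b * suc u) !                                   ≡⟨ cong _! (*-suc b u) ⟩
  (b + b * u) !                                   ≤⟨ [k+n]!≤ b (b * u) ⟩
  (b + b * u) ^ b * (b * u) !                     ≡⟨ cong (λ z → z ^ b * (b * u) !) (*-suc b u) ⟨
  (b * suc u) ^ b * (b * u) !                     ≤⟨ *-monoʳ-≤ ((b * suc u) ^ b) ([bu]!≤ b u) ⟩
  (b * suc u) ^ b * ((b ^ b) ^ u * (u !) ^ b)       ≡⟨ cong (_* ((b ^ b) ^ u * (u !) ^ b)) (*-^ b (suc u) b) ⟩
  b ^ b * suc u ^ b * ((b ^ b) ^ u * (u !) ^ b)     ≡⟨ lem (b ^ b) (suc u ^ b) ((b ^ b) ^ u) ((u !) ^ b) ⟩
  (b ^ b) ^ suc u * (suc u ^ b * (u !) ^ b)         ≡⟨ cong ((b ^ b) ^ suc u *_) (*-^ (suc u) (u !) b) ⟨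
  (b ^ b) ^ suc u * (suc u !) ^ b                   ∎
  where
  open ≤-Reasoning
  lem : ∀ x y z w → x * y * (z * w) ≡ x * z * (y * w)
  lem = solve-∀

[bu]!≥ : ∀ b u → .{{NonZero u}} → (b ^ b) ^ u * (u !) ^ b ≤ (b * u) ^ b * (b * u) !
-- The induction starts at 1, since for `u` zero and `b` positive the right side vanishes.
[bu]!≥ b 1 = begin
  b ^ b * 1 * 1 ^ b               ≡⟨ cong₂ _*_ (*-identityʳ (b ^ b)) (^-zeroˡ b) ⟩
  b ^ b * 1                       ≤⟨ *-mono-≤ (≤-reflexive (cong (_^ b) (sym (*-identityʳ b)))) (1≤n! (b * 1)) ⟩
  (b * 1) ^ b * (b * 1) !         ∎
  where open ≤-Reasoning
[bu]!≥ b (suc u@(suc _)) = begin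
  (b ^ b) ^ suc u * (suc u !) ^ b                   ≡⟨ cong ((b ^ b) ^ suc u *_) (*-^ (suc u) (u !) b) ⟩
  (b ^ b) ^ suc u * (suc u ^ b * (u !) ^ b)         ≡⟨ lem (b ^ b) (suc u ^ b) ((b ^ b) ^ u) ((u !) ^ b) ⟩
  b ^ b * suc u ^ b * ((b ^ b) ^ u * (u !) ^ b)     ≡⟨ cong (_* ((b ^ b) ^ u * (u !) ^ b)) (*-^ b (suc u) b) ⟨
  (b * suc u) ^ b * ((b ^ b) ^ u * (u !) ^ b)       ≤⟨ *-monoʳ-≤ ((b * suc u) ^ b) ([bu]!≥ b u) ⟩
  -- The error factor `(b * u) ^ b` of the induction hypothesis is absorbed by the `b` new factors
  -- of the factorial, so errors do not accumulate.
  (b * suc u) ^ b * ((b * u) ^ b * (b * u) !)     ≤⟨ *-monoʳ-≤ ((b * suc u) ^ b) (n^k*n!≤[k+n]! b (b * u)) ⟩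
  (b * suc u) ^ b * (b + b * u) !                 ≡⟨ cong (λ z → (b * suc u) ^ b * z !) (*-suc b u) ⟨
  (b * suc u) ^ b * (b * suc u) !                 ∎
  where
  open ≤-Reasoning
  lem : ∀ x y z w → x * z * (y * w) ≡ x * y * (z * w)
  lem = solve-∀

2*-div : ∀ h q → .{{_ : NonZero q}} → 2 * (h div q) ≤ (2 * h) div q
2*-div h q@(suc _) = begin
  2 * (h / q)         ≡⟨ m*n/n≡m (2 * (h / q)) q ⟨
  2 * (h / q) * q / q ≡⟨ /-congˡ {o = q} (*-assoc 2 (h / q) q) ⟩
  2 * (h / q * q) / q ≤⟨ /-monoˡ-≤ q (*-monoʳ-≤ 2 (m/n*n≤m h q)) ⟩
  2 * h / q           ∎
  where open ≤-Reasoning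

div-zero : ∀ {m n} → m < n → m div n ≡ 0
div-zero {m} {suc n} m<n = m<n⇒m/n≡0 m<n

div-pos : ∀ {m n} → .{{NonZero n}} → n ≤ m → 1 ≤ m div n
div-pos {m} {suc n} n≤m = m≥n⇒m/n>0 n≤m

upperHalf? : ∀ h p → Dec (h < p × p ≤ 2 * h)
upperHalf? h p = (h <? p) ×-dec (p ≤? 2 * h)

-- Doubling a floor never exceeds the floor of the double. For `h < p ≤ 2 * h` the first term gains
-- one more, since `h div p` is 0 and `(2 * h) div p` is positive.
legendre-double : ∀ R h {p} → .{{NonZero R}} → Prime p →
                  ⟦ upperHalf? h p ⟧ + 2 * legendre R p h ≤ legendre R p (2 * h)
legendre-double (suc R) h {p} pp = begin
  ⟦ upperHalf? h p ⟧ + 2 * ∑< (suc R) f                 ≡⟨ cong (λ z → ⟦ upperHalf? h p ⟧ + 2 * z) (∑<-front R f) ⟩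
  ⟦ upperHalf? h p ⟧ + 2 * (f 0 + ∑< R (λ j → f (suc j))) ≡⟨ lem ⟦ upperHalf? h p ⟧ (f 0) (∑< R (λ j → f (suc j))) ⟩
  (⟦ upperHalf? h p ⟧ + 2 * f 0) + (∑< R (λ j → f (suc j)) + ∑< R (λ j → f (suc j))) ≡⟨ cong ((⟦ upperHalf? h p ⟧ + 2 * f 0) +_) (∑<-+ R _ _) ⟨
  (⟦ upperHalf? h p ⟧ + 2 * f 0) + ∑< R (λ j → f (suc j) + f (suc j)) ≤⟨ +-mono-≤ (first (upperHalf? h p)) (∑<-mono R rest) ⟩
  g 0 + ∑< R (λ j → g (suc j))                          ≡⟨ ∑<-front R g ⟨
  ∑< (suc R) g                                          ∎
  where
  open ≤-Reasoning
  instance _ = prime⇒nonZero pp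
  f g : ℕ → ℕ
  f j = h div p ^ suc j
  g j = (2 * h) div p ^ suc j
  lem : ∀ x y z → x + 2 * (y + z) ≡ (x + 2 * y) + (z + z)
  lem = solve-∀
  rest : ∀ j → f (suc j) + f (suc j) ≤ g (suc j)
  rest j = ≤-trans (≤-reflexive (cong (f (suc j) +_) (sym (+-identityʳ _))))
    (2*-div h (p ^ suc (suc j)) {{m^n≢0 p (suc (suc j))}})
  p^1 : p ≡ p ^ 1
  p^1 = sym (^-identityʳ p)
  first : (d : Dec (h < p × p ≤ 2 * h)) → ⟦ d ⟧ + 2 * f 0 ≤ g 0
  first (yes (h<p , p≤2h)) rewrite div-zero (subst (h <_) p^1 h<p) =
    div-pos {{m^n≢0 p 1}} (subst (_≤ 2 * h) p^1 p≤2h)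
  first (no _) = 2*-div h (p ^ 1) {{m^n≢0 p 1}}

-- Chebyshev's argument: these primes divide the central binomial coefficient, which is at most
-- `4 ^ h`. Its denominator `(h !) ^ 2` is multiplied out, so that only factorials are compared.
primes-upperHalf : ∀ R h → 2 * h < R → ∏< R (λ p → primePart p ^ ⟦ upperHalf? h p ⟧) ≤ 4 ^ h
primes-upperHalf R@(suc _) h 2h<R = *-cancelʳ-≤ _ _ ((h !) ^ 2) {{m^n≢0 (h !) 2 {{h !≢0}}}} (begin
  ∏< R (λ p → primePart p ^ ⟦ upperHalf? h p ⟧) * ((h !) ^ 2)  ≡⟨ cong (∏< R (λ p → primePart p ^ ⟦ upperHalf? h p ⟧) *_) (cong (h ! *_) (*-identityʳ (h !))) ⟩
  ∏< R (λ p → primePart p ^ ⟦ upperHalf? h p ⟧) * (h ! * h !) ≡⟨ cong (λ z → ∏< R (λ p → primePart p ^ ⟦ upperHalf? h p ⟧) * (z * z)) (!-legendre R h (≤-<-trans (m≤m+n h (h + 0)) 2h<R)) ⟩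
  ∏< R A * (∏< R B * ∏< R B)                                 ≡⟨ cong (∏< R A *_) (∏<-* R B B) ⟨
  ∏< R A * ∏< R (λ p → B p * B p)                            ≡⟨ ∏<-* R A _ ⟨
  ∏< R (λ p → A p * (B p * B p))                             ≤⟨ ∏<-mono R step ⟩
  ∏< R (λ p → primePart p ^ legendre R p (2 * h))            ≡⟨ !-legendre R (2 * h) 2h<R ⟨
  (2 * h) !                                                  ≤⟨ [bu]!≤ 2 h ⟩
  4 ^ h * (h !) ^ 2                                            ∎)
  where
  open ≤-Reasoning
  A B : ℕ → ℕ
  A p = primePart p ^ ⟦ upperHalf? h p ⟧
  B p = primePart p ^ legendre R p h
  step : ∀ p → A p * (B p * B p) ≤ primePart p ^ legendre R p (2 * h)
  step p = begin
    A p * (B p * B p)                               ≡⟨ cong (A p *_) (^-distribˡ-+-* (primePart p) (legendre R p h) _) ⟨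
    A p * primePart p ^ (legendre R p h + legendre R p h) ≡⟨ ^-distribˡ-+-* (primePart p) ⟦ upperHalf? h p ⟧ _ ⟨
    primePart p ^ (⟦ upperHalf? h p ⟧ + (legendre R p h + legendre R p h)) ≤⟨ primePart^-mono p (λ pp →
      subst (λ z → ⟦ upperHalf? h p ⟧ + (legendre R p h + z) ≤ legendre R p (2 * h)) (+-identityʳ _) (legendre-double R h pp)) ⟩
    primePart p ^ legendre R p (2 * h)              ∎

-- Primes up to `h` are left to the induction and those in the upper half cost another `4 ^ h`.
-- Powers of two make every halving exact.
primorial-2^ : ∀ R a → 2 ^ a < R → ∏< R (λ p → primePart p ^ ⟦ p ≤? 2 ^ a ⟧) ≤ 4 ^ (2 ^ a)
primorial-2^ R zero lt = ≤-trans (≤-reflexive (∏<-1 R λ p →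
  primePart^-cong p {f = 0} λ pp → ⟦⟧-no (p ≤? 1) (<⇒≱ (prime>1 pp)))) (s≤s z≤n)
primorial-2^ R (suc a) lt = begin
  ∏< R (λ p → primePart p ^ ⟦ p ≤? 2 * h ⟧)       ≤⟨ ∏<-mono R (λ p → primePart^-mono p λ _ →
      ⟦⟧-⊎ (p ≤? 2 * h) (p ≤? h) (upperHalf? h p) (split p)) ⟩
  ∏< R (λ p → primePart p ^ (⟦ p ≤? h ⟧ + ⟦ upperHalf? h p ⟧)) ≡⟨ ∏<-cong R (λ p → ^-distribˡ-+-* (primePart p) ⟦ p ≤? h ⟧ _) ⟩
  ∏< R (λ p → primePart p ^ ⟦ p ≤? h ⟧ * primePart p ^ ⟦ upperHalf? h p ⟧) ≡⟨ ∏<-* R _ _ ⟩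
  ∏< R (λ p → primePart p ^ ⟦ p ≤? h ⟧) * ∏< R (λ p → primePart p ^ ⟦ upperHalf? h p ⟧)
    ≤⟨ *-mono-≤ (primorial-2^ R a (≤-<-trans (m≤m+n h (h + 0)) lt)) (primes-upperHalf R h lt) ⟩
  4 ^ h * 4 ^ h                                   ≡⟨ ^-distribˡ-+-* 4 h h ⟨
  4 ^ (h + h)                                     ≡⟨ cong (λ z → 4 ^ (h + z)) (+-identityʳ h) ⟨
  4 ^ (2 * h)                                     ∎
  where
  open ≤-Reasoning
  h = 2 ^ a
  split : ∀ p → p ≤ 2 * h → p ≤ h ⊎ (h < p × p ≤ 2 * h)
  split p p≤2h with p ≤? h
  ... | yes p≤h = inj₁ p≤h
  ... | no p≰h  = inj₂ (≰⇒> p≰h , p≤2h)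

nextPow2 : ∀ u → .{{NonZero u}} → ∃[ a ] (u ≤ 2 ^ a × 2 ^ a ≤ 2 * u)
nextPow2 1 = 0 , ≤-refl , s≤s z≤n
nextPow2 (suc u@(suc _)) with nextPow2 u
... | a , u≤ , ≤2u with m≤n⇒m<n∨m≡n u≤
...   | inj₁ u<   = a , u< , ≤-trans ≤2u (*-monoʳ-≤ 2 (n≤1+n u))
...   | inj₂ u≡2^a = suc a , subst (λ z → suc u ≤ 2 * z) u≡2^a (+-mono-≤ {1} {u} (s≤s z≤n) (m≤m+n u 0))
                  , *-monoʳ-≤ 2 (≤-trans (≤-reflexive (sym u≡2^a)) (n≤1+n u))

-- Rounding `u` up to a power of two at most doubles it, which turns the base 4 into 16.
primorial : ∀ R u → .{{NonZero u}} → 2 * u < R → ∏< R (λ p → primePart p ^ ⟦ p ≤? u ⟧) ≤ 16 ^ u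
primorial R u 2u<R with nextPow2 u
... | a , u≤2^a , 2^a≤2u = begin
  ∏< R (λ p → primePart p ^ ⟦ p ≤? u ⟧)      ≤⟨ ∏<-mono R (λ p → primePart^-mono p λ _ →
      ⟦⟧-mono (p ≤? u) (p ≤? 2 ^ a) (λ p≤u → ≤-trans p≤u u≤2^a)) ⟩
  ∏< R (λ p → primePart p ^ ⟦ p ≤? 2 ^ a ⟧)  ≤⟨ primorial-2^ R a (≤-<-trans 2^a≤2u 2u<R) ⟩
  4 ^ (2 ^ a)                                ≤⟨ ^-monoʳ-≤ 4 2^a≤2u ⟩
  4 ^ (2 * u)                                ≡⟨ ^-*-assoc 4 2 u ⟨
  16 ^ u                                     ∎
  where open ≤-Reasoning

-- Growth of 2 ^ u

n<2^n : ∀ n → n < 2 ^ n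
n<2^n n = n<m^n 2 n ≤-refl

⌊∜_⌋ : ∀ x → ∃[ r ] (r ^ 4 ≤ x × x < suc r ^ 4)
⌊∜ zero ⌋  = 0 , z≤n , s≤s z≤n
⌊∜ suc x ⌋ with ⌊∜ x ⌋
... | r , r⁴≤x , x<[1+r]⁴ with m≤n⇒m<n∨m≡n x<[1+r]⁴
...   | inj₁ 1+x< = r , ≤-trans r⁴≤x (n≤1+n x) , 1+x<
...   | inj₂ 1+x≡ = suc r , ≤-reflexive (sym 1+x≡) ,
                    subst (_< suc (suc r) ^ 4) (sym 1+x≡) (^-monoˡ-< 4 (n<1+n (suc r)))

-- With r = ⌊∜(M u)⌋ and s = (r + 1)², the exponent of 2 in (M u)^(K + s) is O(r³), while u
-- is of order r⁴.
growth : ∀ M K → .{{NonZero M}} → ∃[ L ] (∀ u → L ≤ u → ∃[ s ] (M * u < s * s × (M * u) ^ (K + s) < 2 ^ u))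
growth M K = B ^ 4 , λ u B⁴≤u → go u B⁴≤u
  where
  -- The exponent of 2, multiplied by `M`, will be at most `4 * M * (K + 4)` times the cube of `r`.
  -- From `B ^ 4 ≤ u` follows `B ≤ r`, so this stays below `r ^ 4`.
  B = suc (4 * M * (K + 4))
  go : ∀ u → B ^ 4 ≤ u → ∃[ s ] (M * u < s * s × (M * u) ^ (K + s) < 2 ^ u)
  go u B⁴≤u with ⌊∜ M * u ⌋
  ... | r , r⁴≤x , x<[1+r]⁴ = s , subst (M * u <_) (lem₁ (suc r)) x<[1+r]⁴ , (begin-strict
    (M * u) ^ (K + s)         ≤⟨ ^-monoˡ-≤ (K + s) (<⇒≤ x<[1+r]⁴) ⟩
    (suc r ^ 4) ^ (K + s)     ≤⟨ ^-monoˡ-≤ (K + s) (^-monoˡ-≤ 4 (n<2^n r)) ⟩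
    ((2 ^ r) ^ 4) ^ (K + s)   ≡⟨ cong (_^ (K + s)) (^-*-assoc 2 r 4) ⟩
    (2 ^ (r * 4)) ^ (K + s)   ≡⟨ ^-*-assoc 2 (r * 4) (K + s) ⟩
    -- The exponents are compared after multiplication by `M`, since `r ^ 4` is bounded by `M * u`
    -- rather than by `u`.
    2 ^ (r * 4 * (K + s))     <⟨ ^-monoʳ-< 2 ≤-refl (*-cancelˡ-< M _ _ exponent) ⟩
    2 ^ u                     ∎)
    where
    open ≤-Reasoning
    s = suc r * suc r
    lem₁ : ∀ y → y * (y * (y * (y * 1))) ≡ y * y * (y * y)
    lem₁ = solve-∀
    B≤r : B ≤ r
    B≤r = ≮⇒≥ λ r<B → <⇒≱ x<[1+r]⁴ (≤-trans (^-monoˡ-≤ 4 r<B) (≤-trans B⁴≤u (m≤n*m u M)))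
    instance
      r≢0 : NonZero r
      r≢0 = >-nonZero (≤-trans (s≤s z≤n) B≤r)
    K+s≤ : K + s ≤ (K + 4) * (r * r)
    K+s≤ = begin
      K + suc r * suc r       ≤⟨ +-mono-≤ (m≤m*n K (r * r) {{m*n≢0 r r}}) (*-mono-≤ 1+r≤2r 1+r≤2r) ⟩
      K * (r * r) + (r + r) * (r + r) ≡⟨ lem₂ K r ⟩
      (K + 4) * (r * r)       ∎
      where
      1+r≤2r : suc r ≤ r + r
      1+r≤2r = +-monoˡ-≤ r (≤-trans (s≤s z≤n) B≤r)
      lem₂ : ∀ K r → K * (r * r) + (r + r) * (r + r) ≡ (K + 4) * (r * r)
      lem₂ = solve-∀
    exponent : M * (r * 4 * (K + s)) < M * u
    exponent = begin-strict
      M * (r * 4 * (K + s))                 ≤⟨ *-monoʳ-≤ M (*-monoʳ-≤ (r * 4) K+s≤) ⟩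
      M * (r * 4 * ((K + 4) * (r * r)))     ≡⟨ lem₃ M r (K + 4) ⟩
      4 * M * (K + 4) * (r * (r * r))       <⟨ *-monoˡ-< (r * (r * r)) {{m*n≢0 r (r * r) {{r≢0}} {{m*n≢0 r r}}}} B≤r ⟩
      r * (r * (r * r))                     ≡⟨ lem₄ r ⟩
      r ^ 4                                 ≤⟨ r⁴≤x ⟩
      M * u                                 ∎
      where
      lem₃ : ∀ M r c → M * (r * 4 * (c * (r * r))) ≡ 4 * M * c * (r * (r * r))
      lem₃ = solve-∀
      lem₄ : ∀ r → r * (r * (r * r)) ≡ r * (r * (r * (r * 1)))
      lem₄ = solve-∀

-- Balanced ratios of factorials

floorSum : List ℕ → ℕ → ℕ
floorSum ks t = sum (map (t div_) ks)

∏!-of : ℕ → List ℕ → ℕ → ℕ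
∏!-of M ks u = product (map (λ k → (M div k * u) !) ks)

-- The base of the exponential growth in `u` of `∏!-of M ks u`, once the powers of `u !` are split
-- off.
entropy : ℕ → List ℕ → ℕ
entropy M ks = product (map (λ k → (M div k) ^ (M div k)) ks)

n^n≢0 : ∀ n → NonZero (n ^ n)
n^n≢0 zero    = _
n^n≢0 (suc n) = m^n≢0 (suc n) (suc n)

entropy≢0 : ∀ M ks → NonZero (entropy M ks)
entropy≢0 M []       = _
entropy≢0 M (k ∷ ks) = m*n≢0 _ _ {{n^n≢0 (M div k)}} {{entropy≢0 M ks}}

-- Multiplies `[bu]!≤` over the list. The exponents of `u !` add up to `floorSum ks M`, so they
-- agree for two lists that are balanced at `M`.
∏!-≤ : ∀ M ks u → ∏!-of M ks u ≤ entropy M ks ^ u * (u !) ^ floorSum ks M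
∏!-≤ M []       u = ≤-reflexive (sym (trans (*-identityʳ (1 ^ u)) (^-zeroˡ u)))
∏!-≤ M (k ∷ ks) u = begin
  (a * u) ! * ∏!-of M ks u                                               ≤⟨ *-mono-≤ ([bu]!≤ a u) (∏!-≤ M ks u) ⟩
  (a ^ a) ^ u * (u !) ^ a * (entropy M ks ^ u * (u !) ^ floorSum ks M)   ≡⟨ lem ((a ^ a) ^ u) _ _ _ ⟩
  (a ^ a) ^ u * entropy M ks ^ u * ((u !) ^ a * (u !) ^ floorSum ks M)   ≡⟨ cong₂ _*_ (*-^ (a ^ a) (entropy M ks) u) (^-distribˡ-+-* (u !) a (floorSum ks M)) ⟨
  entropy M (k ∷ ks) ^ u * (u !) ^ floorSum (k ∷ ks) M                   ∎
  where
  open ≤-Reasoning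
  a = M div k
  lem : ∀ x y z w → x * y * (z * w) ≡ x * z * (y * w)
  lem = solve-∀

div≤ : ∀ m n → m div n ≤ m
div≤ m zero    = z≤n
div≤ m (suc n) = m/n≤m m (suc n)

∏!-≥ : ∀ M ks u → .{{NonZero u}} →
       entropy M ks ^ u * (u !) ^ floorSum ks M ≤ (M * u) ^ floorSum ks M * ∏!-of M ks u
∏!-≥ M []       u = ≤-reflexive (trans (*-identityʳ (1 ^ u)) (^-zeroˡ u))
∏!-≥ M (k ∷ ks) u = begin
  entropy M (k ∷ ks) ^ u * (u !) ^ floorSum (k ∷ ks) M                   ≡⟨ cong₂ _*_ (*-^ (a ^ a) (entropy M ks) u) (^-distribˡ-+-* (u !) a (floorSum ks M)) ⟩
  (a ^ a) ^ u * entropy M ks ^ u * ((u !) ^ a * (u !) ^ floorSum ks M)   ≡⟨ lem ((a ^ a) ^ u) _ _ _ ⟩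
  (a ^ a) ^ u * (u !) ^ a * (entropy M ks ^ u * (u !) ^ floorSum ks M)   ≤⟨ *-mono-≤ ([bu]!≥ a u) (∏!-≥ M ks u) ⟩
  -- Enlarging `a` to `M` in the base collects all error factors into one power of `M * u`.
  (a * u) ^ a * (a * u) ! * ((M * u) ^ floorSum ks M * ∏!-of M ks u)     ≤⟨ *-monoˡ-≤ _ (*-monoˡ-≤ ((a * u) !) (^-monoˡ-≤ a (*-monoˡ-≤ u (div≤ M k)))) ⟩
  (M * u) ^ a * (a * u) ! * ((M * u) ^ floorSum ks M * ∏!-of M ks u)     ≡⟨ lem ((M * u) ^ a) _ _ _ ⟩
  (M * u) ^ a * (M * u) ^ floorSum ks M * ((a * u) ! * ∏!-of M ks u)     ≡⟨ cong (_* ((a * u) ! * ∏!-of M ks u)) (^-distribˡ-+-* (M * u) a (floorSum ks M)) ⟨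
  (M * u) ^ floorSum (k ∷ ks) M * ∏!-of M (k ∷ ks) u                     ∎
  where
  open ≤-Reasoning
  a = M div k
  lem : ∀ x y z w → x * y * (z * w) ≡ x * z * (y * w)
  lem = solve-∀

∏!-legendre : ∀ R M ks u → All (λ k → M div k * u < R) ks →
  ∏!-of M ks u ≡ ∏< R (λ p → primePart p ^ sum (map (λ k → legendre R p (M div k * u)) ks))
∏!-legendre R M []       u []           = sym (∏<-1 R λ p → refl)
∏!-legendre R M (k ∷ ks) u (a<R ∷ as<R) = begin
  (M div k * u) ! * ∏!-of M ks u   ≡⟨ cong₂ _*_ (!-legendre R (M div k * u) a<R) (∏!-legendre R M ks u as<R) ⟩
  _                                ≡⟨ ∏<-* R _ _ ⟨
  _                                ≡⟨ ∏<-cong R (λ p → ^-distribˡ-+-* (primePart p) (legendre R p (M div k * u)) _) ⟨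
  _                                ∎
  where open ≡-Reasoning

divisor≢0 : ∀ {k M} → .{{NonZero M}} → k ∣ M → NonZero k
divisor≢0 {zero}  {M} 0∣M = contradiction (0∣⇒≡0 0∣M) (≢-nonZero⁻¹ M)
divisor≢0 {suc k}     _   = _

-- Nested floors merge, so both sides are the floor of `M * u` over `q * k`. Hence the exponents
-- depend on a prime power `q` only through `(M * u) div q`.
div-div : ∀ {k M} u q → .{{NonZero q}} → .{{NonZero M}} → k ∣ M →
          (M div k * u) div q ≡ ((M * u) div q) div k
div-div {k} {M} u q k∣M = begin
  (M div k * u) div q       ≡⟨ div≡/ _ q ⟩
  (M div k * u) / q         ≡⟨ m*n/o*n≡m/o (M div k * u) k q {{_}} {{m*n≢0 q k}} ⟨
  _/_ (M div k * u * k) (q * k) {{m*n≢0 q k}}   ≡⟨ /-congˡ {o = q * k} {{m*n≢0 q k}} eq ⟩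
  _/_ (M * u) (q * k) {{m*n≢0 q k}}             ≡⟨ m/n/o≡m/[n*o] (M * u) q k {{_}} {{_}} {{m*n≢0 q k}} ⟨
  (M * u) / q / k           ≡⟨ div≡/ _ k ⟨
  (M * u) / q div k         ≡⟨ cong (_div k) (div≡/ (M * u) q) ⟨
  ((M * u) div q) div k     ∎
  where
  open ≡-Reasoning
  instance
    k≢0 : NonZero k
    k≢0 = divisor≢0 k∣M
  eq : M div k * u * k ≡ M * u
  eq = trans (lem (M div k) u k) (cong (_* u) (trans (cong (_* k) (div≡/ M k)) (m/n*n≡m k∣M)))
    where
    lem : ∀ a u k → a * u * k ≡ a * k * u
    lem = solve-∀

sum-legendre : ∀ R M ks u p → .{{NonZero M}} → .{{NonZero p}} → All (_∣ M) ks →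
  sum (map (λ k → legendre R p (M div k * u)) ks) ≡ ∑< R (λ j → floorSum ks ((M * u) div p ^ suc j))
sum-legendre R M []       u p []           = sym (∑<-0 R λ j → refl)
sum-legendre R M (k ∷ ks) u p (k∣M ∷ ks∣M) = trans
  (cong₂ _+_ (∑<-cong R λ j → div-div u (p ^ suc j) {{m^n≢0 p (suc j)}} k∣M) (sum-legendre R M ks u p ks∣M))
  (sym (∑<-+ R _ _))

-- A full period adds the exact integer `floorSum ks M`. For balanced lists these additions cancel,
-- and the difference of the two floor sums is periodic modulo `M`.
floorSum-+ : ∀ M ks r h → .{{NonZero M}} → All (_∣ M) ks →
             floorSum ks (r + h * M) ≡ floorSum ks r + h * floorSum ks M
floorSum-+ M []       r h []           = sym (*-zeroʳ h)
floorSum-+ M (k ∷ ks) r h (k∣M ∷ ks∣M) = begin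
  (r + h * M) div k + floorSum ks (r + h * M)                   ≡⟨ cong₂ _+_ head (floorSum-+ M ks r h ks∣M) ⟩
  (r div k + h * (M div k)) + (floorSum ks r + h * floorSum ks M) ≡⟨ lem (r div k) h (M div k) (floorSum ks r) (floorSum ks M) ⟩
  (r div k + floorSum ks r) + h * (M div k + floorSum ks M)     ∎
  where
  open ≡-Reasoning
  instance
    k≢0 : NonZero k
    k≢0 = divisor≢0 k∣M
  lem : ∀ a h b c d → (a + h * b) + (c + h * d) ≡ (a + c) + h * (b + d)
  lem = solve-∀
  head : (r + h * M) div k ≡ r div k + h * (M div k)
  head = begin
    (r + h * M) div k         ≡⟨ div≡/ (r + h * M) k ⟩
    (r + h * M) / k           ≡⟨ +-distrib-/-∣ʳ r (∣n⇒∣m*n h k∣M) ⟩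
    r / k + h * M / k         ≡⟨ cong (r / k +_) (*-/-assoc h k∣M) ⟩
    r / k + h * (M / k)       ≡⟨ cong₂ (λ x y → x + h * y) (div≡/ r k) (div≡/ M k) ⟨
    r div k + h * (M div k)   ∎

-- Induction from the top: if `p ^ suc R` is at most `X`, even counting all `suc R` indices is
-- harmless; otherwise the top index contributes nothing.
p^count≤ : ∀ R p X → .{{NonZero p}} → .{{NonZero X}} → p ^ ∑< R (λ j → ⟦ p ^ suc j ≤? X ⟧) ≤ X
p^count≤ zero    p X = >-nonZero⁻¹ X
p^count≤ (suc R) p X = bound (p ^ suc R ≤? X)
  where
  count : ℕ
  count = ∑< R (λ j → ⟦ p ^ suc j ≤? X ⟧)
  bound : (d : Dec (p ^ suc R ≤ X)) → p ^ (count + ⟦ d ⟧) ≤ X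
  bound (yes p^≤X) = ≤-trans (^-monoʳ-≤ p (≤-trans (+-monoˡ-≤ 1 (length≤ R)) (≤-reflexive (+-comm R 1)))) p^≤X
    where
    length≤ : ∀ n → ∑< n (λ j → ⟦ p ^ suc j ≤? X ⟧) ≤ n
    length≤ zero    = z≤n
    length≤ (suc n) = ≤-trans (+-mono-≤ (length≤ n) (⟦⟧≤1 (p ^ suc n ≤? X))) (≤-reflexive (+-comm n 1))
  bound (no _)     = subst (λ z → p ^ z ≤ X) (sym (+-identityʳ count)) (p^count≤ R p X)

-- From a balanced pair of divisor lists to primes in the interval

module Balanced
  (w : ℕ) .{{w≢0 : NonZero w}} (ks⁺ ks⁻ : List ℕ)
  (ks⁺∣ : All (_∣ 72 * w) ks⁺) (ks⁻∣ : All (_∣ 72 * w) ks⁻)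
  (8≤ks⁺ : All (8 ≤_) ks⁺) (8≤ks⁻ : All (8 ≤_) ks⁻)
  (balanced : floorSum ks⁺ (72 * w) ≡ floorSum ks⁻ (72 * w))
  (dominated : ∀ r → r < 72 * w → floorSum ks⁺ r ≤ floorSum ks⁻ r + ⟦ r ≟ 8 ⟧)
  (gain : 32 * entropy (72 * w) ks⁻ ≤ entropy (72 * w) ks⁺)
  where

  -- A multiple of 72, so that the ends of the window, `M * u` over 9 and over 8, are the integers
  -- `8 * (w * u)` and `9 * (w * u)`.
  M : ℕ
  M = 72 * w

  instance
    M≢0 : NonZero M
    M≢0 = m*n≢0 72 w

  -- An upper bound for the difference of the floor sums. Residues 8 in later periods are covered by
  -- counting every `t` from `M` on, which for a large prime means `p ≤ u`.
  excess : ℕ → ℕ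
  excess t = ⟦ t ≟ 8 ⟧ + ⟦ M ≤? t ⟧

  floorSum-excess : ∀ t → floorSum ks⁺ t ≤ floorSum ks⁻ t + excess t
  floorSum-excess t = begin
    floorSum ks⁺ t                          ≡⟨ cong (floorSum ks⁺) t≡ ⟩
    floorSum ks⁺ (r + h * M)                ≡⟨ floorSum-+ M ks⁺ r h ks⁺∣ ⟩
    floorSum ks⁺ r + h * floorSum ks⁺ M     ≤⟨ +-monoˡ-≤ _ (dominated r (m%n<n t M)) ⟩
    floorSum ks⁻ r + ⟦ r ≟ 8 ⟧ + h * floorSum ks⁺ M ≡⟨ cong (λ z → floorSum ks⁻ r + ⟦ r ≟ 8 ⟧ + h * z) balanced ⟩
    floorSum ks⁻ r + ⟦ r ≟ 8 ⟧ + h * floorSum ks⁻ M ≡⟨ lem (floorSum ks⁻ r) ⟦ r ≟ 8 ⟧ _ ⟩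
    floorSum ks⁻ r + h * floorSum ks⁻ M + ⟦ r ≟ 8 ⟧ ≡⟨ cong (_+ ⟦ r ≟ 8 ⟧) (floorSum-+ M ks⁻ r h ks⁻∣) ⟨
    floorSum ks⁻ (r + h * M) + ⟦ r ≟ 8 ⟧    ≡⟨ cong (λ z → floorSum ks⁻ z + ⟦ r ≟ 8 ⟧) t≡ ⟨
    floorSum ks⁻ t + ⟦ r ≟ 8 ⟧              ≤⟨ +-monoʳ-≤ (floorSum ks⁻ t) (⟦⟧-⊎ (r ≟ 8) (t ≟ 8) (M ≤? t) (split h t≡)) ⟩
    floorSum ks⁻ t + excess t               ∎
    where
    open ≤-Reasoning
    r = t % M
    h = t / M
    t≡ : t ≡ r + h * M
    t≡ = m≡m%n+[m/n]*n t M
    lem : ∀ a b c → a + b + c ≡ a + c + b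
    lem = solve-∀
    split : ∀ h → t ≡ r + h * M → r ≡ 8 → t ≡ 8 ⊎ M ≤ t
    split zero    eq r≡8 = inj₁ (trans eq (trans (+-identityʳ r) r≡8))
    split (suc h) eq r≡8 = inj₂ (≤-trans (≤-trans (m≤m+n M (h * M)) (m≤n+m _ r)) (≤-reflexive (sym eq)))

  72≤M : 72 ≤ M
  72≤M = m≤m*n 72 w

  excess-0 : excess 0 ≡ 0
  excess-0 = cong₂ _+_ (⟦⟧-no (0 ≟ 8) λ ()) (⟦⟧-no (M ≤? 0) (<⇒≱ (≤-trans (s≤s z≤n) 72≤M)))

  -- The two indicators exclude each other, as `M` is at least 72.
  excess≤1 : ∀ t → excess t ≤ 1
  excess≤1 t with t ≟ 8
  ... | yes refl = ≤-reflexive (cong suc (⟦⟧-no (M ≤? 8) (<⇒≱ (≤-trans (m≤m+n 9 63) 72≤M))))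
  ... | no t≢8   = ≤-trans (≤-reflexive (cong (_+ ⟦ M ≤? t ⟧) (⟦⟧-no (t ≟ 8) t≢8))) (⟦⟧≤1 (M ≤? t))

  module _ (u R s : ℕ) .{{u≢0 : NonZero u}} (9wu<R : 9 * (w * u) < R) (X<s² : M * u < s * s) where

    X : ℕ
    X = M * u

    instance
      X≢0 : NonZero X
      X≢0 = m*n≢0 M u

    -- The upper end of the window is left to the range `R` of the sums, which is later
    -- `suc (9 * n)`.
    InWindow : ℕ → Set
    InWindow p = Prime p × X < 9 * p

    inWindow? : ∀ p → Dec (InWindow p)
    inWindow? p = prime? p ×-dec (X <? 9 * p)

    [M/k]*u<R : ∀ {k} → 8 ≤ k → M div k * u < R
    [M/k]*u<R {k@(suc _)} 8≤k = ≤-<-trans (≤-trans (*-monoˡ-≤ u M/k≤) (≤-reflexive (*-assoc 9 w u))) 9wu<R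
      where
      M/k≤ : M / k ≤ 9 * w
      M/k≤ = *-cancelʳ-≤ (M / k) (9 * w) 8 (begin
        M / k * 8       ≤⟨ *-monoʳ-≤ (M / k) 8≤k ⟩
        M / k * k       ≤⟨ m/n*n≤m M k ⟩
        72 * w          ≡⟨ lem w ⟩
        9 * w * 8       ∎)
        where
        open ≤-Reasoning
        lem : ∀ w → 72 * w ≡ 9 * w * 8
        lem = solve-∀

    excessExp : ℕ → ℕ
    excessExp p = ∑< R (λ j → excess (X div p ^ suc j))

    -- A bound for what the index `p` contributes to the ratio. All three factors are at least 1, so
    -- overlaps between the cases do no harm.
    weight : ℕ → ℕ
    weight p = X ^ ⟦ p ≤? s ⟧ * primePart p ^ ⟦ p ≤? u ⟧ * X ^ ⟦ inWindow? p ⟧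

    -- Each power of `p` up to `X` adds at most 1 to the exponent, and higher powers add nothing.
    weight-small : ∀ {p} → Prime p → p ≤ s → p ^ excessExp p ≤ X
    weight-small {p} pp p≤s = ≤-trans (^-monoʳ-≤ p (∑<-mono R step)) (p^count≤ R p X)
      where
      instance _ = prime⇒nonZero pp
      step : ∀ j → excess (X div p ^ suc j) ≤ ⟦ p ^ suc j ≤? X ⟧
      step j with p ^ suc j ≤? X
      ... | yes q≤X = ≤-trans (excess≤1 (X div p ^ suc j)) (≤-reflexive (sym (⟦⟧-yes (p ^ suc j ≤? X) q≤X)))
      ... | no q≰X  = ≤-trans (≤-reflexive (trans (cong excess (div-zero (≰⇒> q≰X))) excess-0)) z≤n

    -- As `p * p` exceeds `X`, only the first power counts. With `t` the quotient of `X` by `p`, the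
    -- case `M ≤ t` forces `p ≤ u`, and `t ≡ 8` puts `p` into the window with `p ≤ X`.
    weight-large : ∀ {p} → Prime p → s < p → p ^ excessExp p ≤ p ^ ⟦ p ≤? u ⟧ * X ^ ⟦ inWindow? p ⟧
    weight-large {p} pp s<p = begin
      p ^ excessExp p                          ≤⟨ ^-monoʳ-≤ p (∑<-head R _ λ j → trans (cong excess (div-zero (X<p^ j))) excess-0) ⟩
      p ^ excess t                             ≡⟨ cong (p ^_) (+-comm ⟦ t ≟ 8 ⟧ _) ⟩
      p ^ (⟦ M ≤? t ⟧ + ⟦ t ≟ 8 ⟧)             ≡⟨ ^-distribˡ-+-* p ⟦ M ≤? t ⟧ ⟦ t ≟ 8 ⟧ ⟩
      p ^ ⟦ M ≤? t ⟧ * p ^ ⟦ t ≟ 8 ⟧           ≤⟨ *-mono-≤ (^-monoʳ-≤ p (⟦⟧-mono (M ≤? t) (p ≤? u) p≤u)) (windowFactor (t ≟ 8)) ⟩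
      p ^ ⟦ p ≤? u ⟧ * X ^ ⟦ inWindow? p ⟧     ∎
      where
      open ≤-Reasoning
      instance _ = prime⇒nonZero pp
      t = X div p ^ 1
      t≡ : t ≡ X / p
      t≡ = trans (cong (X div_) (^-identityʳ p)) (div≡/ X p)
      X<p^ : ∀ j → X < p ^ suc (suc j)
      X<p^ j = begin-strict
        X                 <⟨ X<s² ⟩
        s * s             ≤⟨ *-mono-≤ (<⇒≤ s<p) (<⇒≤ s<p) ⟩
        p * p             ≤⟨ m≤m*n (p * p) (p ^ j) {{m^n≢0 p j}} ⟩
        p * p * p ^ j     ≡⟨ *-assoc p p (p ^ j) ⟩
        p ^ suc (suc j)   ∎
      p≤u : M ≤ t → p ≤ u
      p≤u M≤t = *-cancelˡ-≤ M (begin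
        M * p             ≤⟨ *-monoˡ-≤ p (≤-trans M≤t (≤-reflexive t≡)) ⟩
        X / p * p         ≤⟨ m/n*n≤m X p ⟩
        M * u             ∎)
      windowFactor : (d : Dec (t ≡ 8)) → p ^ ⟦ d ⟧ ≤ X ^ ⟦ inWindow? p ⟧
      windowFactor (no _)    = m^n>0 X ⟦ inWindow? p ⟧
      windowFactor (yes t≡8) = begin
        p ^ 1                   ≡⟨ ^-identityʳ p ⟩
        p                       ≤⟨ m≤n*m p 8 ⟩
        8 * p                   ≤⟨ 8p≤X ⟩
        X                       ≡⟨ ^-identityʳ X ⟨
        X ^ 1                   ≡⟨ cong (X ^_) (⟦⟧-yes (inWindow? p) (pp , X<9p)) ⟨
        X ^ ⟦ inWindow? p ⟧     ∎
        where
        X/p≡8 : X / p ≡ 8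
        X/p≡8 = trans (sym t≡) t≡8
        8p≤X : 8 * p ≤ X
        8p≤X = subst (λ z → z * p ≤ X) X/p≡8 (m/n*n≤m X p)
        X<9p : X < 9 * p
        X<9p = begin-strict
          X                     ≡⟨ m≡m%n+[m/n]*n X p ⟩
          X % p + X / p * p     <⟨ +-monoˡ-< (X / p * p) (m%n<n X p) ⟩
          p + X / p * p         ≡⟨ cong (λ z → p + z * p) X/p≡8 ⟩
          9 * p                 ∎

    excess≤weight : ∀ p → primePart p ^ excessExp p ≤ weight p
    excess≤weight p = go (prime? p) (p ≤? s)
      where
      open ≤-Reasoning
      e = excessExp p
      instance
        π≢0 : NonZero (primePart p)
        π≢0 = primePart>0 p
      A = X ^ ⟦ p ≤? s ⟧
      B = primePart p ^ ⟦ p ≤? u ⟧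
      C = X ^ ⟦ inWindow? p ⟧
      A>0 : 1 ≤ A
      A>0 = m^n>0 X ⟦ p ≤? s ⟧
      B>0 : 1 ≤ B
      B>0 = m^n>0 (primePart p) ⟦ p ≤? u ⟧
      C>0 : 1 ≤ C
      C>0 = m^n>0 X ⟦ inWindow? p ⟧
      go : Dec (Prime p) → Dec (p ≤ s) → primePart p ^ e ≤ A * B * C
      go (no ¬pp) _ = begin
        primePart p ^ e   ≡⟨ cong (_^ e) (primePart-¬prime ¬pp) ⟩
        1 ^ e             ≡⟨ ^-zeroˡ e ⟩
        1                 ≤⟨ *-mono-≤ (*-mono-≤ A>0 B>0) C>0 ⟩
        A * B * C         ∎
      go (yes pp) (yes p≤s) = begin
        primePart p ^ e   ≡⟨ cong (_^ e) (primePart-prime pp) ⟩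
        p ^ e             ≤⟨ weight-small pp p≤s ⟩
        X                 ≡⟨ ^-identityʳ X ⟨
        X ^ 1             ≡⟨ cong (X ^_) (⟦⟧-yes (p ≤? s) p≤s) ⟨
        A                 ≤⟨ m≤m*n A B {{>-nonZero B>0}} ⟩
        A * B             ≤⟨ m≤m*n (A * B) C {{>-nonZero C>0}} ⟩
        A * B * C         ∎
      go (yes pp) (no p≰s) = begin
        primePart p ^ e               ≡⟨ cong (_^ e) (primePart-prime pp) ⟩
        p ^ e                         ≤⟨ weight-large pp (≰⇒> p≰s) ⟩
        p ^ ⟦ p ≤? u ⟧ * C            ≡⟨ cong (λ z → z ^ ⟦ p ≤? u ⟧ * C) (primePart-prime pp) ⟨
        B * C                         ≤⟨ m≤n*m (B * C) A {{>-nonZero A>0}} ⟩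
        A * (B * C)                   ≡⟨ *-assoc A B C ⟨
        A * B * C                     ∎

    small : ℕ
    small = ∑< R (λ p → ⟦ p ≤? s ⟧)

    window : ℕ
    window = ∑< R (λ p → ⟦ inWindow? p ⟧)

    ∏weight≤ : ∏< R weight ≤ X ^ small * 16 ^ u * X ^ window
    ∏weight≤ = begin
      ∏< R weight                                                ≡⟨ ∏<-* R _ _ ⟩
      ∏< R (λ p → X ^ ⟦ p ≤? s ⟧ * primePart p ^ ⟦ p ≤? u ⟧) * ∏< R (λ p → X ^ ⟦ inWindow? p ⟧)
        ≡⟨ cong₂ _*_ (∏<-* R _ _) (∏<-^ X R _) ⟩
      ∏< R (λ p → X ^ ⟦ p ≤? s ⟧) * ∏< R (λ p → primePart p ^ ⟦ p ≤? u ⟧) * X ^ window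
        ≤⟨ *-monoˡ-≤ (X ^ window) (*-mono-≤ (≤-reflexive (∏<-^ X R _)) (primorial R u 2u<R)) ⟩
      X ^ small * 16 ^ u * X ^ window                            ∎
      where
      open ≤-Reasoning
      2u<R : 2 * u < R
      2u<R = ≤-<-trans (*-mono-≤ {2} {9} (s≤s (s≤s z≤n)) (m≤n*m u w)) 9wu<R

    -- Exponents are compared prime by prime: Legendre's formula and `floorSum-excess` leave a
    -- surplus of at most `excessExp p`, which `weight` pays for.
    ∏!-ratio≤ : ∏!-of M ks⁺ u ≤ ∏!-of M ks⁻ u * ∏< R weight
    ∏!-ratio≤ = begin
      ∏!-of M ks⁺ u                                   ≡⟨ ∏!-legendre R M ks⁺ u (All.map [M/k]*u<R 8≤ks⁺) ⟩
      ∏< R (λ p → primePart p ^ E ks⁺ p)              ≤⟨ ∏<-mono R (λ p → primePart^-mono p (exponents p)) ⟩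
      ∏< R (λ p → primePart p ^ (E ks⁻ p + excessExp p)) ≡⟨ ∏<-cong R (λ p → ^-distribˡ-+-* (primePart p) (E ks⁻ p) _) ⟩
      ∏< R (λ p → primePart p ^ E ks⁻ p * primePart p ^ excessExp p) ≤⟨ ∏<-mono R (λ p → *-monoʳ-≤ (primePart p ^ E ks⁻ p) (excess≤weight p)) ⟩
      ∏< R (λ p → primePart p ^ E ks⁻ p * weight p)   ≡⟨ ∏<-* R _ _ ⟩
      ∏< R (λ p → primePart p ^ E ks⁻ p) * ∏< R weight ≡⟨ cong (_* ∏< R weight) (∏!-legendre R M ks⁻ u (All.map [M/k]*u<R 8≤ks⁻)) ⟨
      ∏!-of M ks⁻ u * ∏< R weight                     ∎
      where
      open ≤-Reasoning
      E : List ℕ → ℕ → ℕ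
      E ks p = sum (map (λ k → legendre R p (M div k * u)) ks)
      exponents : ∀ p → Prime p → E ks⁺ p ≤ E ks⁻ p + excessExp p
      exponents p pp = begin
        E ks⁺ p                                                     ≡⟨ sum-legendre R M ks⁺ u p ks⁺∣ ⟩
        ∑< R (λ j → floorSum ks⁺ (X div p ^ suc j))                 ≤⟨ ∑<-mono R (λ j → floorSum-excess (X div p ^ suc j)) ⟩
        ∑< R (λ j → floorSum ks⁻ (X div p ^ suc j) + excess (X div p ^ suc j)) ≡⟨ ∑<-+ R _ _ ⟩
        ∑< R (λ j → floorSum ks⁻ (X div p ^ suc j)) + excessExp p   ≡⟨ cong (_+ excessExp p) (sum-legendre R M ks⁻ u p ks⁻∣) ⟨
        E ks⁻ p + excessExp p                                       ∎
        where instance _ = prime⇒nonZero pp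

    -- Confronts the lower and the upper estimate of the factorial ratio, with denominators cleared.
    -- Of the 32 in `gain`, 16 cancels against the primes up to `u` and 2 survives; the powers of
    -- `u !` cancel by balance.
    2^u≤X^ : 2 ^ u ≤ X ^ (floorSum ks⁻ M + small + window)
    2^u≤X^ = *-cancelʳ-≤ (2 ^ u) _ (16 ^ u * β ^ u * u!^S) (begin
      2 ^ u * (16 ^ u * β ^ u * u!^S)                 ≡⟨ lem₁ (2 ^ u) (16 ^ u) (β ^ u) u!^S ⟩
      2 ^ u * 16 ^ u * β ^ u * u!^S                   ≡⟨ cong (_* u!^S) (trans (*-^ 32 β u) (cong (_* β ^ u) (*-^ 2 16 u))) ⟨
      (32 * β) ^ u * u!^S                             ≤⟨ *-monoˡ-≤ u!^S (^-monoˡ-≤ u gain) ⟩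
      entropy M ks⁺ ^ u * u!^S                        ≡⟨ cong (λ z → entropy M ks⁺ ^ u * (u !) ^ z) balanced ⟨
      entropy M ks⁺ ^ u * (u !) ^ floorSum ks⁺ M      ≤⟨ ∏!-≥ M ks⁺ u ⟩
      X ^ floorSum ks⁺ M * ∏!-of M ks⁺ u              ≡⟨ cong (λ z → X ^ z * ∏!-of M ks⁺ u) balanced ⟩
      X ^ S * ∏!-of M ks⁺ u                           ≤⟨ *-monoʳ-≤ (X ^ S) (≤-trans ∏!-ratio≤ (*-mono-≤ (∏!-≤ M ks⁻ u) ∏weight≤)) ⟩
      X ^ S * (β ^ u * u!^S * (X ^ small * 16 ^ u * X ^ window)) ≡⟨ lem₂ (X ^ S) (β ^ u) u!^S (X ^ small) (16 ^ u) (X ^ window) ⟩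
      X ^ S * X ^ small * X ^ window * (16 ^ u * β ^ u * u!^S) ≡⟨ cong (_* (16 ^ u * β ^ u * u!^S)) (trans (^-distribˡ-+-* X (S + small) window) (cong (_* X ^ window) (^-distribˡ-+-* X S small))) ⟨
      X ^ (S + small + window) * (16 ^ u * β ^ u * u!^S) ∎)
      where
      open ≤-Reasoning
      S = floorSum ks⁻ M
      β = entropy M ks⁻
      u!^S = (u !) ^ S
      instance
        cancel≢0 : NonZero (16 ^ u * β ^ u * u!^S)
        cancel≢0 = m*n≢0 _ _ {{m*n≢0 _ _ {{m^n≢0 16 u}} {{m^n≢0 β u {{entropy≢0 M ks⁻}}}}}} {{m^n≢0 (u !) S {{u !≢0}}}}
      lem₁ : ∀ a b c d → a * (b * c * d) ≡ a * b * c * d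
      lem₁ = solve-∀
      lem₂ : ∀ a b c d e f → a * (b * c * (d * e * f)) ≡ a * d * f * (e * b * c)
      lem₂ = solve-∀

    small≤ : small ≤ suc s
    small≤ = count-≤ R 0 (suc s) (λ p → p ≤? s) (λ p p≤s → z≤n , s≤s p≤s)

  primes-in-[8n,9n] : ∀ m → ∃[ L ] (0 < L × (∀ n → L ≤ n → m ≤ #primesIn[ 8 * n , 9 * n ]))
  -- For `n` from `w * suc L` on, the quotient `u` of `n` by `w` is positive and beyond the
  -- threshold of `growth`.
  primes-in-[8n,9n] m = w * suc L , >-nonZero⁻¹ (w * suc L) {{m*n≢0 w (suc L)}} , enough
    where
    -- `K + s` is the exponent in `2^u≤X^` under the assumption of too few primes: at most `suc s`
    -- small indices, `m` primes in the interval and `8 * w` integers at its edge.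
    K = floorSum ks⁻ M + 1 + (m + 8 * w)
    L = proj₁ (growth M K)
    enough : ∀ n → w * suc L ≤ n → m ≤ #primesIn[ 8 * n , 9 * n ]
    enough n wL≤n = ≮⇒≥ λ few → <⇒≱ X^<2^u (begin
      2 ^ u                                       ≤⟨ 2^u≤X^ u R s 9wu<R X<s² ⟩
      X′ ^ (floorSum ks⁻ M + small′ + window′)    ≤⟨ ^-monoʳ-≤ X′ (begin
        floorSum ks⁻ M + small′ + window′             ≤⟨ +-mono-≤ (+-monoʳ-≤ (floorSum ks⁻ M) (small≤ u R s 9wu<R X<s²))
                                                           (≤-trans window≤ (+-monoˡ-≤ (8 * w) (<⇒≤ few))) ⟩
        floorSum ks⁻ M + suc s + (m + 8 * w)          ≡⟨ lem (floorSum ks⁻ M) s (m + 8 * w) ⟩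
        K + s                                         ∎) ⟩
      X′ ^ (K + s)                                ∎)
      where
      open ≤-Reasoning
      u = n / w
      -- Indices below `R` are those up to `9 * n`, as in the list of the theorem.
      R = suc (9 * n)
      1+L≤u : suc L ≤ u
      1+L≤u = begin
        suc L             ≡⟨ m*n/n≡m (suc L) w ⟨
        suc L * w / w     ≤⟨ /-monoˡ-≤ w (≤-trans (≤-reflexive (*-comm (suc L) w)) wL≤n) ⟩
        n / w             ∎
      instance
        u≢0 : NonZero u
        u≢0 = >-nonZero (≤-trans (s≤s z≤n) 1+L≤u)
      grown = proj₂ (growth M K) u (≤-trans (n≤1+n L) 1+L≤u)
      s = proj₁ grown
      X<s² = proj₁ (proj₂ grown)
      X^<2^u = proj₂ (proj₂ grown)
      wu≤n : w * u ≤ n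
      wu≤n = ≤-trans (≤-reflexive (*-comm w u)) (m/n*n≤m n w)
      n≤w+wu : n ≤ w + w * u
      n≤w+wu = begin
        n                 ≡⟨ m≡m%n+[m/n]*n n w ⟩
        n % w + n / w * w ≤⟨ +-mono-≤ (<⇒≤ (m%n<n n w)) (≤-reflexive (*-comm u w)) ⟩
        w + w * u         ∎
      9wu<R : 9 * (w * u) < R
      9wu<R = s≤s (*-monoʳ-≤ 9 wu≤n)
      X′ = X u R s 9wu<R X<s²
      small′ = small u R s 9wu<R X<s²
      window′ = window u R s 9wu<R X<s²
      instance
        X′≢0 : NonZero X′
        X′≢0 = m*n≢0 M u
      lem : ∀ a b c → a + suc b + c ≡ a + 1 + c + b
      lem = solve-∀
      X≡ : M * u ≡ 72 * (w * u)
      X≡ = *-assoc 72 w u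
      -- Rounding `n` down to `w * u` moves the lower end of the window below `8 * n` by at most
      -- `8 * w`, so at most that many of its primes are lost.
      window≤ : window′ ≤ #primesIn[ 8 * n , 9 * n ] + 8 * w
      window≤ = begin
        window′                                        ≤⟨ ∑<-mono R (λ p → ⟦⟧-⊎ (inWindow? u R s 9wu<R X<s² p) (inside? p) (edge? p) (split p)) ⟩
        ∑< R (λ p → ⟦ inside? p ⟧ + ⟦ edge? p ⟧)       ≡⟨ ∑<-+ R _ _ ⟩
        ∑< R (λ p → ⟦ inside? p ⟧) + ∑< R (λ p → ⟦ edge? p ⟧)
          ≤⟨ +-mono-≤ (≤-reflexive (sym (length-filter-upTo inside? R))) (count-≤ R (8 * (w * u)) (8 * w) edge? (λ p e → e)) ⟩
        #primesIn[ 8 * n , 9 * n ] + 8 * w             ∎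
        where
        inside? : ∀ p → Dec (8 * n ≤ p × Prime p)
        inside? p = (8 * n ≤? p) ×-dec prime? p
        edge? : ∀ p → Dec (8 * (w * u) ≤ p × p < 8 * (w * u) + 8 * w)
        edge? p = (8 * (w * u) ≤? p) ×-dec (p <? 8 * (w * u) + 8 * w)
        split : ∀ p → InWindow u R s 9wu<R X<s² p →
                (8 * n ≤ p × Prime p) ⊎ (8 * (w * u) ≤ p × p < 8 * (w * u) + 8 * w)
        split p (pp , X<9p) with 8 * n ≤? p
        ... | yes 8n≤p = inj₁ (8n≤p , pp)
        ... | no 8n≰p  = inj₂ (*-cancelˡ-≤ 9 (begin
          9 * (8 * (w * u))  ≡⟨ *-assoc 9 8 (w * u) ⟨
          72 * (w * u)       ≡⟨ X≡ ⟨
          M * u              ≤⟨ <⇒≤ X<9p ⟩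
          9 * p              ∎) , (begin-strict
          p                      <⟨ ≰⇒> 8n≰p ⟩
          8 * n                  ≤⟨ *-monoʳ-≤ 8 n≤w+wu ⟩
          8 * (w + w * u)        ≡⟨ *-distribˡ-+ 8 w (w * u) ⟩
          8 * w + 8 * (w * u)    ≡⟨ +-comm (8 * w) _ ⟩
          8 * (w * u) + 8 * w    ∎))

-- The choice of divisors of 5040

-- Found by linear programming: numerator-dominated is the constraint, and the growth rate
-- log (entropy numerator / entropy denominator) ≈ 3.98 of the factorial ratio the objective;
-- log 32 ≈ 3.47 is needed.
numerator denominator : List ℕ
numerator   = 8 ∷ 18 ∷ 28 ∷ 45 ∷ 48 ∷ 63 ∷ 80 ∷ 112 ∷ 120 ∷ 168 ∷ 180 ∷ 280 ∷ 280 ∷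
              420 ∷ 420 ∷ 1008 ∷ 1008 ∷ 5040 ∷ 5040 ∷ 5040 ∷ []
denominator = 9 ∷ 16 ∷ 24 ∷ 40 ∷ 56 ∷ 56 ∷ 84 ∷ 90 ∷ 126 ∷ 140 ∷ 144 ∷ 240 ∷ 360 ∷
              560 ∷ 840 ∷ []

-- A finite check over one full period of 5040 residues.
numerator-dominated : ∀ r → r < 72 * 70 → floorSum numerator r ≤ floorSum denominator r + ⟦ r ≟ 8 ⟧
numerator-dominated r r< = toWitness
  {a? = allUpTo? (λ r → floorSum numerator r ≤? floorSum denominator r + ⟦ r ≟ 8 ⟧) (72 * 70)} tt r<

entropy-gain : 32 * entropy (72 * 70) denominator ≤ entropy (72 * 70) numerator
-- Both sides have thousands of digits, so they are compared by the Boolean test, which evaluates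
-- quickly.
entropy-gain = ≤ᵇ⇒≤ (32 * entropy (72 * 70) denominator) (entropy (72 * 70) numerator) tt

theorem4p0p4 : ∀ (m : ℕ) → 0 < m →
    ∃[ L ] (0 < L × (∀ (n : ℕ) → L ≤ n → m ≤ #primesIn[ 8 * n , 9 * n ]))
-- The period 5040 is `72 * 70`, hence `w` is 70. The argument `refl` verifies by evaluation that
-- the lists are balanced.
theorem4p0p4 m _ = Balanced.primes-in-[8n,9n] 70 numerator denominator
  (toWitness {a? = all? (_∣? 72 * 70) numerator} tt)
  (toWitness {a? = all? (_∣? 72 * 70) denominator} tt)
  (toWitness {a? = all? (8 ≤?_) numerator} tt)
  (toWitness {a? = all? (8 ≤?_) denominator} tt)
  refl numerator-dominated entropy-gain m
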